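{- Let $F_1(q)=\sum_{n\ge 0}f_1(n)q^n$ be the generating function of the number of $1$-convex permutations by length (with $f_1(0)=1$). Then, as formal power series, $$F_1(q)=1+q-2q^2\,\frac{1+\mathrm{bot}(q)\,q^2+\mathrm{tot}(q)\,q}{ -1+q+\mathrm{bot}(q)\,q^3},$$ where $\mathrm{bot}(q)$ and $\mathrm{tot}(q)$ are the generating functions by length of the walks in the digraph $T$ from the root $v_1$ to $v_1$, and of all the walks in $T$ starting at $v_1$, respectively.
   Context: A permutation $\pi:[n]\to[n]$, where $[n]=\{1,\ldots,n\}$, is $1$-convex if $\pi(i-1)+\pi(i+1)-2\pi(i)\le 1$ for all $i\in\{2,\ldots,n-1\}$; $f_1(n)$ is the number of $1$-convex permutations of length $n$. The infinite digraph $T$ has main vertices $v_1,v_2,v_3,\ldots$ (in the paper $v_l$ is the node written $12(l+1)(l+2)$, so $v_1=1223$, $v_2=1234$, $v_3=1245$, and so on). For each $l\ge 1$ there is one edge $v_l\to v_{l+1}$, and there is a directed path with exactly $l+2$ edges from $v_{l+1}$ to $v_l$, whose $l+1$ intermediate vertices are additional vertices of $T$ lying on no other edges (so the return path $v_2\to v_1$ has $3$ edges, $v_3\to v_2$ has $4$ edges, $v_4\to v_3$ has $5$ edges, etc.). There are no other vertices or edges. The length of a walk is its number of edges; the empty walk (length $0$) is counted. Walks counted by $\mathrm{tot}(q)$ may end at any vertex of $T$, including the intermediate vertices of the return paths. -}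

module Defs where

open import Data.Empty using (⊥-elim)
open import Data.Fin.Base using (Fin; zero; suc; toℕ; fromℕ; inject₁; combine; finToFun; funToFin)
import Data.Fin.Properties as Fin
open import Data.Fin.Permutation using (Permutation′; _⟨$⟩ʳ_; _⟨$⟩ˡ_; permutation; inverseˡ; inverseʳ)
open import Data.Integer.Base as ℤ using (ℤ; +_; 0ℤ; 1ℤ; -1ℤ)
import Data.Integer.Properties as ℤ
open import Data.Integer.Tactic.RingSolver using (solve-∀)
open import Data.Nat.Base as ℕ using (ℕ; zero; suc)
import Data.Nat.Properties as ℕ
open import Data.Product.Base using (Σ; ∃; _×_; _,_; proj₁; proj₂)
open import Data.Sum.Base using (_⊎_; inj₁; inj₂)
open import Data.Sum.Function.Propositional using (_⊎-↔_)
open import Function.Bundles using (Inverse; _↔_; mk↔ₛ′)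
import Function.Construct.Composition as Compose
open import Level using (0ℓ)
open import Relation.Binary.Bundles using (Setoid)
import Relation.Binary.Construct.On as On
open import Relation.Binary.PropositionalEquality
  using (_≡_; refl; sym; trans; cong; cong₂; setoid; _→-setoid_; module ≡-Reasoning)
open import Relation.Nullary using (Dec; yes; no)
open import Relation.Nullary.Decidable using (_×-dec_; _→-dec_)
open import Relation.Unary using (Decidable)

------------------------------------------------------------------------
-- Cardinality of finite setoids

record Finite (S : Setoid 0ℓ 0ℓ) : Set where
  constructor finite
  field
    card        : ℕ
    enumeration : Inverse (setoid (Fin card)) S

open Finite public

transfer : ∀ {S T : Setoid 0ℓ 0ℓ} → Inverse S T → Finite S → Finite T
transfer i (finite k e) = finite k (Compose.inverse e i)

------------------------------------------------------------------------
-- 1-convex permutations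

-- [n] is represented by Fin n.  Counting from 0 instead of 1 shifts all
-- values of π by 1, which leaves π(i-1) + π(i+1) - 2π(i) unchanged.
-- The indices i, j, k are the three consecutive positions i, i+1, i+2.

OneConvex : ∀ {n} → (Fin n → Fin n) → Set
OneConvex {n} π = ∀ (i j k : Fin n) → toℕ j ≡ suc (toℕ i) → toℕ k ≡ suc (toℕ j) →
  val i ℤ.+ val k ℤ.- (+ 2) ℤ.* val j ℤ.≤ 1ℤ
  where
  val : Fin n → ℤ
  val x = + toℕ (π x)

-- Permutations are identified when they agree as functions.

OneConvexPermutation : ℕ → Setoid 0ℓ 0ℓ
OneConvexPermutation n =
  On.setoid {B = Σ (Permutation′ n) λ π → OneConvex (π ⟨$⟩ʳ_)}
    (Fin n →-setoid Fin n) (λ p → proj₁ p ⟨$⟩ʳ_)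

subset : ∀ {m} → (Fin m → Set) → Setoid 0ℓ 0ℓ
subset {m} P = On.setoid {B = Σ (Fin m) P} (setoid (Fin m)) proj₁

subset-finite : ∀ {m} {P : Fin m → Set} → Decidable P → Finite (subset P)
subset-finite {zero} P? = finite 0 record
  { to = λ () ; from = λ () ; to-cong = λ { {()} } ; from-cong = λ { {() , _} }
  ; inverse = (λ { {() , _} }) , (λ { {()} }) }
subset-finite {suc m} {P} P? with P? zero | subset-finite {m} {λ i → P (suc i)} (λ i → P? (suc i))
... | yes p | finite k e = finite (suc k) record
  { to = to ; from = from ; to-cong = λ { refl → refl }
  ; from-cong = λ {x} {y} → from-cong {x} {y}
  ; inverse = (λ { {x} refl → to-from x })
            , (λ {i} {x} eq → trans (from-cong {x} {to i} eq) (from-to i)) }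
  where
  module E = Inverse e
  to : Fin (suc k) → Σ (Fin (suc m)) P
  to zero    = zero , p
  to (suc i) = suc (proj₁ (E.to i)) , proj₂ (E.to i)
  from : Σ (Fin (suc m)) P → Fin (suc k)
  from (zero  , _) = zero
  from (suc i , q) = suc (E.from (i , q))
  from-cong : ∀ {x y} → proj₁ x ≡ proj₁ y → from x ≡ from y
  from-cong {zero  , _} {zero  , _} _    = refl
  from-cong {suc i , _} {suc _ , _} refl = cong suc (E.from-cong refl)
  to-from : ∀ x → proj₁ (to (from x)) ≡ proj₁ x
  to-from (zero  , _) = refl
  to-from (suc i , q) = cong suc (E.strictlyInverseˡ (i , q))
  from-to : ∀ i → from (to i) ≡ i
  from-to zero    = refl
  from-to (suc i) = cong suc (E.strictlyInverseʳ i)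
... | no ¬p | finite k e = finite k record
  { to = to ; from = from ; to-cong = λ { refl → refl }
  ; from-cong = λ {x} {y} → from-cong {x} {y}
  ; inverse = (λ { {x} refl → to-from x })
            , (λ {i} {x} eq → trans (from-cong {x} {to i} eq) (E.strictlyInverseʳ i)) }
  where
  module E = Inverse e
  to : Fin k → Σ (Fin (suc m)) P
  to i = suc (proj₁ (E.to i)) , proj₂ (E.to i)
  from : Σ (Fin (suc m)) P → Fin k
  from (zero  , q) = ⊥-elim (¬p q)
  from (suc i , q) = E.from (i , q)
  from-cong : ∀ {x y} → proj₁ x ≡ proj₁ y → from x ≡ from y
  from-cong {zero  , q} _ = ⊥-elim (¬p q)
  from-cong {suc i , _} {suc _ , _} refl = E.from-cong refl
  to-from : ∀ x → proj₁ (to (from x)) ≡ proj₁ x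
  to-from (zero  , q) = ⊥-elim (¬p q)
  to-from (suc i , q) = cong suc (E.strictlyInverseˡ (i , q))

Admissible : ∀ {n} → (Fin n → Fin n) → Set
Admissible f = ((∀ x y → f x ≡ f y → x ≡ y) × (∀ y → ∃ λ x → f x ≡ y)) × OneConvex f

admissible? : ∀ {n} (f : Fin n → Fin n) → Dec (Admissible f)
admissible? f =
  (Fin.all? (λ x → Fin.all? λ y → (f x Fin.≟ f y) →-dec (x Fin.≟ y))
    ×-dec Fin.all? (λ y → Fin.any? λ x → f x Fin.≟ y))
  ×-dec Fin.all? (λ i → Fin.all? λ j → Fin.all? λ k →
    (toℕ j ℕ.≟ suc (toℕ i)) →-dec ((toℕ k ℕ.≟ suc (toℕ j)) →-dec (_ ℤ.≤? _)))

OneConvex-resp : ∀ {n} {f g : Fin n → Fin n} → (∀ x → f x ≡ g x) → OneConvex f → OneConvex g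
OneConvex-resp eq c i j k p q with c i j k p q
... | r rewrite eq i | eq j | eq k = r

toPermutation : ∀ {n} {f : Fin n → Fin n} → Admissible f → Permutation′ n
toPermutation {f = f} ((inj , surj) , _) =
  permutation f (λ y → proj₁ (surj y)) (λ y → proj₂ (surj y))
    (λ x → inj _ _ (proj₂ (surj (f x))))

fromPermutation : ∀ {n} (π : Permutation′ n) → OneConvex (π ⟨$⟩ʳ_) → ∀ {f} →
                  (∀ x → π ⟨$⟩ʳ x ≡ f x) → Admissible f
fromPermutation π c {f} eq =
  ( (λ x y e → trans (sym (inverseˡ π))
      (trans (cong (π ⟨$⟩ˡ_) (trans (eq x) (trans e (sym (eq y))))) (inverseˡ π)))
  , (λ y → π ⟨$⟩ˡ y , trans (sym (eq _)) (inverseʳ π)))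
  , OneConvex-resp eq c

funToFin-cong : ∀ {m n} {f g : Fin m → Fin n} → (∀ x → f x ≡ g x) → funToFin f ≡ funToFin g
funToFin-cong {zero}  _  = refl
funToFin-cong {suc m} eq = cong₂ combine (eq zero) (funToFin-cong (λ x → eq (suc x)))

OneConvexPermutation-finite : ∀ n → Finite (OneConvexPermutation n)
OneConvexPermutation-finite n =
  transfer bij (subset-finite {P = λ i → Admissible (finToFun {n} {n} i)} (λ i → admissible? (finToFun i)))
  where
  bij : Inverse (subset λ i → Admissible (finToFun {n} {n} i)) (OneConvexPermutation n)
  bij = record
    { to        = λ (i , a) → toPermutation a , proj₂ a
    ; from      = λ (π , c) → funToFin (π ⟨$⟩ʳ_)
                , fromPermutation π c (λ x → sym (Fin.finToFun-funToFin (π ⟨$⟩ʳ_) x))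
    ; to-cong   = λ { refl x → refl }
    ; from-cong = funToFin-cong
    ; inverse   = (λ { {π , _} refl x → Fin.finToFun-funToFin (π ⟨$⟩ʳ_) x })
                , (λ {i} eq → trans (funToFin-cong eq) (Fin.funToFin-finToFin {n} {n} (proj₁ i)))
    }

f₁ : ℕ → ℕ
f₁ n = card (OneConvexPermutation-finite n)

------------------------------------------------------------------------
-- The digraph T

-- main l is the vertex v_{l+1}.  The vertices return l i are the l + 2
-- intermediate vertices of the path from v_{l+2} to v_{l+1}, where i
-- counts down: the distance from return l i to v_{l+1} is i + 1.

data Vertex : Set where
  main   : ℕ → Vertex
  return : (l : ℕ) → Fin (suc (suc l)) → Vertex

data Edge : Vertex → Vertex → Set where
  up    : ∀ {l}   → Edge (main l) (main (suc l))
  leave : ∀ {l}   → Edge (main (suc l)) (return l (fromℕ (suc l)))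
  down  : ∀ {l i} → Edge (return l (suc i)) (return l (inject₁ i))
  enter : ∀ {l}   → Edge (return l zero) (main l)

v₁ : Vertex
v₁ = main 0

data Walk : ℕ → Vertex → Vertex → Set where
  []  : ∀ {u} → Walk 0 u u
  _∷_ : ∀ {n u v w} → Edge u v → Walk n v w → Walk (suc n) u w

⊎-finite : ∀ {A B : Set} → Finite (setoid A) → Finite (setoid B) → Finite (setoid (A ⊎ B))
⊎-finite (finite k e) (finite m f) =
  finite (k ℕ.+ m) (Compose.inverse (Fin.+↔⊎ {k} {m}) (e ⊎-↔ f))

step-finite : ∀ {Q : Vertex → Set} → (∀ v → Finite (setoid (Q v))) →
              ∀ u → Finite (setoid (∃ λ v → Edge u v × Q v))
step-finite fin (main zero) = transfer
  (mk↔ₛ′ (λ q → _ , up , q) (λ { (_ , up , q) → q }) (λ { (_ , up , q) → refl }) (λ _ → refl))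
  (fin _)
step-finite fin (main (suc l)) = transfer
  (mk↔ₛ′ (λ { (inj₁ q) → _ , up , q ; (inj₂ q) → _ , leave , q })
         (λ { (_ , up , q) → inj₁ q ; (_ , leave , q) → inj₂ q })
         (λ { (_ , up , q) → refl ; (_ , leave , q) → refl })
         (λ { (inj₁ q) → refl ; (inj₂ q) → refl }))
  (⊎-finite (fin _) (fin _))
step-finite fin (return l zero) = transfer
  (mk↔ₛ′ (λ q → _ , enter , q) (λ { (_ , enter , q) → q }) (λ { (_ , enter , q) → refl }) (λ _ → refl))
  (fin _)
step-finite fin (return l (suc i)) = transfer
  (mk↔ₛ′ (λ q → _ , down , q) (λ { (_ , down , q) → q }) (λ { (_ , down , q) → refl }) (λ _ → refl))
  (fin _)

WalkFrom-finite : ∀ n u → Finite (setoid (∃ λ w → Walk n u w))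
WalkFrom-finite zero u = finite 1
  (mk↔ₛ′ (λ _ → u , []) (λ _ → zero) (λ { (_ , []) → refl }) (λ { zero → refl }))
WalkFrom-finite (suc n) u = transfer prepend (step-finite (WalkFrom-finite n) u)
  where
  prepend : (∃ λ v → Edge u v × ∃ λ w → Walk n v w) ↔ (∃ λ w → Walk (suc n) u w)
  prepend = mk↔ₛ′ (λ { (_ , e , w , p) → w , e ∷ p }) (λ { (w , e ∷ p) → _ , e , w , p })
                  (λ { (w , e ∷ p) → refl }) (λ { (_ , _ , _ , _) → refl })

WalkTo-v₁-finite : ∀ n u → Finite (setoid (Walk n u v₁))
WalkTo-v₁-finite zero (main zero) = finite 1
  (mk↔ₛ′ (λ _ → []) (λ _ → zero) (λ { [] → refl }) (λ { zero → refl }))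
WalkTo-v₁-finite zero (main (suc l)) = finite 0
  (mk↔ₛ′ (λ ()) (λ ()) (λ ()) (λ ()))
WalkTo-v₁-finite zero (return l i) = finite 0
  (mk↔ₛ′ (λ ()) (λ ()) (λ ()) (λ ()))
WalkTo-v₁-finite (suc n) u = transfer prepend (step-finite (WalkTo-v₁-finite n) u)
  where
  prepend : (∃ λ v → Edge u v × Walk n v v₁) ↔ Walk (suc n) u v₁
  prepend = mk↔ₛ′ (λ { (_ , e , p) → e ∷ p }) (λ { (e ∷ p) → _ , e , p }) (λ { (e ∷ p) → refl }) (λ { (_ , _ , _) → refl })

botCount : ℕ → ℕ
botCount n = card (WalkTo-v₁-finite n v₁)

totCount : ℕ → ℕ
totCount n = card (WalkFrom-finite n v₁)

------------------------------------------------------------------------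
-- Formal power series over ℤ, as coefficient sequences

Series : Set
Series = ℕ → ℤ

infix  4 _≈_
infixl 6 _+_ _-_
infixl 7 _*_ _/_⟨_⟩
infixr 8 _^_

_≈_ : Series → Series → Set
f ≈ g = ∀ n → f n ≡ g n

const : ℤ → Series
const c zero    = c
const c (suc _) = 0ℤ

q : Series
q 1 = 1ℤ
q _ = 0ℤ

_+_ _-_ _*_ : Series → Series → Series
(f + g) n = f n ℤ.+ g n
(f - g) n = f n ℤ.- g n

-- Cauchy product f₀gₙ + f₁gₙ₋₁ + ⋯ + fₙg₀
(f * g) zero    = f 0 ℤ.* g 0
(f * g) (suc n) = f 0 ℤ.* g (suc n) ℤ.+ ((λ m → f (suc m)) * g) n

_^_ : Series → ℕ → Series
f ^ zero  = const 1ℤ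
f ^ suc k = f * f ^ k

IsUnit : ℤ → Set
IsUnit c = ∃ λ u → u ℤ.* c ≡ 1ℤ

-- Long division: f / g has constant term c = f₀/g₀, and its remaining
-- terms are the quotient of (f - c g)/q by g.
_/_⟨_⟩ : Series → (g : Series) → IsUnit (g 0) → Series
(f / g ⟨ u , _ ⟩) zero       = u ℤ.* f 0
(f / g ⟨ unit@(u , _) ⟩) (suc n) =
  ((λ m → f (suc m) ℤ.- (u ℤ.* f 0) ℤ.* g (suc m)) / g ⟨ unit ⟩) n

/-*-cancel : ∀ f g (unit : IsUnit (g 0)) → (f / g ⟨ unit ⟩) * g ≈ f
/-*-cancel f g (u , ug≡1) zero = begin
  u ℤ.* f 0 ℤ.* g 0    ≡⟨ swap u (f 0) (g 0) ⟩
  u ℤ.* g 0 ℤ.* f 0    ≡⟨ cong (ℤ._* f 0) ug≡1 ⟩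
  1ℤ ℤ.* f 0           ≡⟨ ℤ.*-identityˡ (f 0) ⟩
  f 0                  ∎
  where
  open ≡-Reasoning
  swap : ∀ a b c → a ℤ.* b ℤ.* c ≡ a ℤ.* c ℤ.* b
  swap = solve-∀
/-*-cancel f g unit@(u , _) (suc n) =
  trans (cong (λ x → u ℤ.* f 0 ℤ.* g (suc n) ℤ.+ x) (/-*-cancel _ g unit n))
        (collect (u ℤ.* f 0 ℤ.* g (suc n)) (f (suc n)))
  where
  collect : ∀ a b → a ℤ.+ (b ℤ.- a) ≡ b
  collect = solve-∀

genFun : (ℕ → ℕ) → Series
genFun a n = + a n

F₁ bot tot : Series
F₁  = genFun f₁
bot = genFun botCount
tot = genFun totCount

denominator : Series
denominator = const -1ℤ + q + bot * q ^ 3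

denominator-unit : IsUnit (denominator 0)
denominator-unit = -1ℤ , refl

{-# OPTIONS --safe #-}
-- The minimum of a 1-convex permutation sits at one of its ends, and removing it
-- leaves a 1-convex permutation.  Hence such permutations are built, from the
-- largest value downwards, by choosing an end for each new minimum, and whether
-- an end is available depends only on its last value and its last gap.  Up to
-- exchanging the ends, the resulting automaton is T together with a state in
-- which everything is allowed, entered whenever v₁ is left otherwise than upwards.
-- With G n half the number of 1-convex permutations of length n + 2, this gives
-- G = 1 + q G + q (tot + bot · q (1 + q G)), that is
-- (q - 1 + bot q³) (-G) = 1 + bot q² + tot q.
module Submission where

open import Defs
open import Data.Bool.Base using (if_then_else_)
open import Data.Fin.Base using (Fin; zero; suc; toℕ; fromℕ; fromℕ<; inject₁; opposite)
open import Data.Fin.Permutation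
  using (Permutation′; _⟨$⟩ʳ_; _⟨$⟩ˡ_; _∘ₚ_; id; reverse; lift₀; lift₀-cong; lift₀-remove; remove; inverseˡ; inverseʳ; ↔⇒≡)
import Data.Fin.Properties as Fin
open import Data.Integer.Base as ℤ using (ℤ; +_; 0ℤ; 1ℤ; -1ℤ)
import Data.Integer.Properties as ℤ
import Data.Integer.Tactic.RingSolver as ℤ-Solver
open import Data.Nat.Base as ℕ using (ℕ; zero; suc; _≤_; z≤n; s≤s)
import Data.Nat.Properties as ℕ
open import Data.Nat.Tactic.RingSolver using (solve-∀)
open import Data.Product.Base using (∃; _×_; _,_; proj₁; proj₂)
open import Data.Sum.Base using (_⊎_; inj₁; inj₂)
open import Data.Sum.Function.Propositional using (_⊎-↔_)
open import Function.Base using (_∘_)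
open import Function.Bundles using (Inverse; _↔_; mk↔ₛ′)
import Function.Construct.Composition as Compose
import Function.Construct.Symmetry as Symmetry
open import Function.Properties.Bijection using (Bijection⇒Inverse)
open import Relation.Binary.PropositionalEquality
  using (_≡_; _≢_; _≗_; refl; sym; trans; cong; cong₂; subst; subst₂; setoid; module ≡-Reasoning)
open import Relation.Nullary using (Dec; yes; no; does; ¬_; Irrelevant)
open import Relation.Nullary.Decidable using (dec-true; dec-false)
open import Relation.Nullary.Negation using (contradiction)

-- Power series

tail : Series → Series
tail f n = f (suc n)

*-cong : ∀ {f f′ g g′} → f ≈ f′ → g ≈ g′ → f * g ≈ f′ * g′
*-cong f≈ g≈ zero    = cong₂ ℤ._*_ (f≈ 0) (g≈ 0)
*-cong f≈ g≈ (suc n) =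
  cong₂ ℤ._+_ (cong₂ ℤ._*_ (f≈ 0) (g≈ (suc n))) (*-cong (f≈ ∘ suc) g≈ n)

*-distribʳ-+ : ∀ h f g → (f + g) * h ≈ f * h + g * h
*-distribʳ-+ h f g zero    = ℤ.*-distribʳ-+ (h 0) (f 0) (g 0)
*-distribʳ-+ h f g (suc n) =
  trans (cong (λ x → (f 0 ℤ.+ g 0) ℤ.* h (suc n) ℤ.+ x) (*-distribʳ-+ h (tail f) (tail g) n))
        (regroup (f 0) (g 0) (h (suc n)) ((tail f * h) n) ((tail g * h) n))
  where
  regroup : ∀ a b c x y →
    (a ℤ.+ b) ℤ.* c ℤ.+ (x ℤ.+ y) ≡ (a ℤ.* c ℤ.+ x) ℤ.+ (b ℤ.* c ℤ.+ y)
  regroup = ℤ-Solver.solve-∀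

-- The product is defined by recursion on its first factor. Splitting off the last term instead
-- gives recursion on the second, as commutativity and multiplication by `q` on the right require.
*-suc : ∀ f g n → (f * g) (suc n) ≡ (f * tail g) n ℤ.+ f (suc n) ℤ.* g 0
*-suc f g zero    = refl
*-suc f g (suc n) =
  trans (cong (λ x → f 0 ℤ.* g (suc (suc n)) ℤ.+ x) (*-suc (tail f) g n))
        (sym (ℤ.+-assoc (f 0 ℤ.* g (suc (suc n))) _ _))

*-comm : ∀ f g → f * g ≈ g * f
*-comm f g zero    = ℤ.*-comm (f 0) (g 0)
*-comm f g (suc n) = begin
  f 0 ℤ.* g (suc n) ℤ.+ (tail f * g) n ≡⟨ cong₂ ℤ._+_ (ℤ.*-comm (f 0) _) (*-comm (tail f) g n) ⟩
  g (suc n) ℤ.* f 0 ℤ.+ (g * tail f) n ≡⟨ ℤ.+-comm _ ((g * tail f) n) ⟩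
  (g * tail f) n ℤ.+ g (suc n) ℤ.* f 0 ≡⟨ *-suc g f n ⟨
  (g * f) (suc n)                      ∎
  where open ≡-Reasoning

zero-* : ∀ f → (λ _ → 0ℤ) * f ≈ λ _ → 0ℤ
zero-* f zero    = refl
zero-* f (suc n) = trans (ℤ.+-identityˡ _) (zero-* f n)

const-* : ∀ c f n → (const c * f) n ≡ c ℤ.* f n
const-* c f zero    = refl
const-* c f (suc n) =
  trans (cong (λ x → c ℤ.* f (suc n) ℤ.+ x) (zero-* f n)) (ℤ.+-identityʳ _)

q-*-suc : ∀ f n → (q * f) (suc n) ≡ f n
q-*-suc f n = begin
  0ℤ ℤ.* f (suc n) ℤ.+ (tail q * f) n ≡⟨ ℤ.+-identityˡ _ ⟩
  (tail q * f) n                      ≡⟨ *-cong {f = tail q} {g = f} tail-q (λ _ → refl) n ⟩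
  (const 1ℤ * f) n                    ≡⟨ const-* 1ℤ f n ⟩
  1ℤ ℤ.* f n                          ≡⟨ ℤ.*-identityˡ (f n) ⟩
  f n                                 ∎
  where
  open ≡-Reasoning
  tail-q : tail q ≈ const 1ℤ
  tail-q zero    = refl
  tail-q (suc _) = refl

*-q-suc : ∀ f g n → (f * (q * g)) (suc n) ≡ (f * g) n
*-q-suc f g n = begin
  (f * (q * g)) (suc n)                             ≡⟨ *-suc f (q * g) n ⟩
  (f * tail (q * g)) n ℤ.+ f (suc n) ℤ.* 0ℤ         ≡⟨ cong₂ ℤ._+_ (*-cong {f} (λ _ → refl) (q-*-suc g) n) (ℤ.*-zeroʳ (f (suc n))) ⟩
  (f * g) n ℤ.+ 0ℤ                                  ≡⟨ ℤ.+-identityʳ _ ⟩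
  (f * g) n                                         ∎
  where open ≡-Reasoning

*-identityʳ : ∀ f → f * const 1ℤ ≈ f
*-identityʳ f n = trans (*-comm f (const 1ℤ) n) (trans (const-* 1ℤ f n) (ℤ.*-identityˡ (f n)))

neg-* : ∀ f g → (λ n → ℤ.- f n) * g ≈ λ n → ℤ.- (f * g) n
neg-* f g zero    = sym (ℤ.neg-distribˡ-* (f 0) (g 0))
neg-* f g (suc n) = trans
  (cong₂ ℤ._+_ (sym (ℤ.neg-distribˡ-* (f 0) (g (suc n)))) (neg-* (tail f) g n))
  (sym (ℤ.neg-distrib-+ (f 0 ℤ.* g (suc n)) ((tail f * g) n)))

*-q²-suc : ∀ f n → (const (+ 2) * q ^ 2 * f) (2 ℕ.+ n) ≡ + 2 ℤ.* f n
*-q²-suc f n = begin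
  0ℤ ℤ.* f (2 ℕ.+ n) ℤ.+ (0ℤ ℤ.* f (1 ℕ.+ n) ℤ.+ (tail (tail 2q²) * f) n)
    ≡⟨ trans (ℤ.+-identityˡ _) (ℤ.+-identityˡ _) ⟩
  (tail (tail 2q²) * f) n
    ≡⟨ *-cong {g = f} coefficient (λ _ → refl) n ⟩
  (const (+ 2) * f) n
    ≡⟨ const-* (+ 2) f n ⟩
  + 2 ℤ.* f n ∎
  where
  open ≡-Reasoning
  2q² : Series
  2q² = const (+ 2) * q ^ 2
  coefficient : tail (tail 2q²) ≈ const (+ 2)
  coefficient zero    = refl
  coefficient (suc n) = trans (const-* (+ 2) (q ^ 2) (3 ℕ.+ n))
    (cong (λ x → + 2 ℤ.* x) (trans (q-*-suc (q ^ 1) (2 ℕ.+ n)) (q-*-suc (const 1ℤ) (1 ℕ.+ n))))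

-- The invertible constant term of `g` forces the first coefficient of `h`. What long division then
-- leaves to be divided is `tail h * g`, so the later coefficients follow by induction.
quotient-unique : ∀ {f g h} (unit : IsUnit (g 0)) → h * g ≈ f → f / g ⟨ unit ⟩ ≈ h
quotient-unique {f} {g} {h} (u , ug≡1) hg≈f zero = begin
  u ℤ.* f 0           ≡⟨ cong (u ℤ.*_) (hg≈f 0) ⟨
  u ℤ.* (h 0 ℤ.* g 0) ≡⟨ swap u (h 0) (g 0) ⟩
  u ℤ.* g 0 ℤ.* h 0   ≡⟨ cong (ℤ._* h 0) ug≡1 ⟩
  1ℤ ℤ.* h 0          ≡⟨ ℤ.*-identityˡ (h 0) ⟩
  h 0                 ∎
  where
  open ≡-Reasoning
  swap : ∀ a b c → a ℤ.* (b ℤ.* c) ≡ a ℤ.* c ℤ.* b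
  swap = ℤ-Solver.solve-∀
quotient-unique {f} {g} {h} unit hg≈f (suc n) = quotient-unique {h = tail h} unit remainder n
  where
  open ≡-Reasoning
  cancel : ∀ a b → b ≡ (a ℤ.+ b) ℤ.- a
  cancel = ℤ-Solver.solve-∀
  remainder : tail h * g ≈ λ m → f (suc m) ℤ.- (f / g ⟨ unit ⟩) 0 ℤ.* g (suc m)
  remainder m = begin
    (tail h * g) m                                          ≡⟨ cancel (h 0 ℤ.* g (suc m)) _ ⟩
    (h * g) (suc m) ℤ.- h 0 ℤ.* g (suc m)                   ≡⟨ cong₂ (λ x y → x ℤ.- y ℤ.* g (suc m)) (hg≈f (suc m)) (sym (quotient-unique {h = h} unit hg≈f 0)) ⟩
    f (suc m) ℤ.- (f / g ⟨ unit ⟩) 0 ℤ.* g (suc m)          ∎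

-- Counting ways to prepend or append a new minimum

-- (a , g) describes one end of a permutation: the outermost value is a and the
-- next one is a + g (g = 0 if the next one is smaller or missing).  Putting a
-- new minimum 0 outside of it shifts these values by 1, so 1-convexity asks for
-- 0 + (a + g + 1) - 2(a + 1) ≤ 1.
End : Set
End = ℕ × ℕ

Open : End → Set
Open (a , g) = g ≤ 2 ℕ.+ a

open? : ∀ e → Dec (Open e)
open? (a , g) = g ℕ.≤? 2 ℕ.+ a

extend bury : End → End
extend (a , _) = 0 , suc a
bury (a , g) = suc a , g

when : ∀ {A : Set} → Dec A → ℕ → ℕ
when a? k = if does a? then k else 0

when-yes : ∀ {A : Set} (a? : Dec A) {k} → A → when a? k ≡ k
when-yes a? a rewrite dec-true a? a = refl

when-no : ∀ {A : Set} (a? : Dec A) {k} → ¬ A → when a? k ≡ 0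
when-no a? ¬a rewrite dec-false a? ¬a = refl

completions : ℕ → End → End → ℕ
completions zero    l r = 1
completions (suc n) l r =
  when (open? l) (completions n (extend l) (bury r)) ℕ.+
  when (open? r) (completions n (bury l) (extend r))

completions-swap : ∀ n l r → completions n l r ≡ completions n r l
completions-swap zero    l r = refl
completions-swap (suc n) l r = trans
  (cong₂ ℕ._+_ (cong (when (open? l)) (completions-swap n (extend l) (bury r)))
               (cong (when (open? r)) (completions-swap n (bury l) (extend r))))
  (ℕ.+-comm (when (open? l) _) _)

-- The second summand is mirrored so that the end used last always comes first, the convention
-- behind `G` and `Simulates`.
completions-both : ∀ n {l r} → Open l → Open r →
  completions (suc n) l r ≡ completions n (extend l) (bury r) ℕ.+ completions n (extend r) (bury l)
completions-both n {l} {r} ol or = cong₂ ℕ._+_ (when-yes (open? l) ol)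
  (trans (when-yes (open? r) or) (completions-swap n (bury l) (extend r)))

completions-left : ∀ n {l r} → Open l → ¬ Open r →
  completions (suc n) l r ≡ completions n (extend l) (bury r)
completions-left n {l} {r} ol ¬or = trans
  (cong₂ ℕ._+_ (when-yes (open? l) ol) (when-no (open? r) ¬or)) (ℕ.+-identityʳ _)

completions-right : ∀ n {l r} → ¬ Open l → Open r →
  completions (suc n) l r ≡ completions n (extend r) (bury l)
completions-right n {l} {r} ¬ol or = trans
  (cong₂ ℕ._+_ (when-no (open? l) ¬ol) (when-yes (open? r) or)) (completions-swap n (bury l) (extend r))

-- A gap is read only by `Open`: `extend` discards it, and `bury` raises the outermost value, which
-- keeps an open end open.
open-gap-irrelevant : ∀ n {a g h} r → Open (a , g) → Open (a , h) →
  completions n (a , g) r ≡ completions n (a , h) r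
open-gap-irrelevant zero    r og oh = refl
open-gap-irrelevant (suc n) {a} {g} {h} r og oh = cong₂ ℕ._+_
  (trans (when-yes (open? (a , g)) og) (sym (when-yes (open? (a , h)) oh)))
  (cong (when (open? r)) (open-gap-irrelevant n (extend r) (ℕ.m≤n⇒m≤1+n og) (ℕ.m≤n⇒m≤1+n oh)))

-- By f₁-suc-suc below, G n is half the number of 1-convex permutations of
-- length n + 2.
G : ℕ → ℕ
G n = completions n (0 , 1) (1 , 0)

-- The bounds 2 and 3 say that both ends are open, so the actual gaps can be replaced by those of
-- `G`.
open-completions : ∀ n {g h} → g ≤ 2 → h ≤ 3 → completions n (0 , g) (1 , h) ≡ G n
open-completions n {g} {h} g≤2 h≤3 = begin
  completions n (0 , g) (1 , h) ≡⟨ open-gap-irrelevant n _ g≤2 (s≤s z≤n) ⟩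
  completions n (0 , 1) (1 , h) ≡⟨ completions-swap n _ _ ⟩
  completions n (1 , h) (0 , 1) ≡⟨ open-gap-irrelevant n _ h≤3 z≤n ⟩
  completions n (1 , 0) (0 , 1) ≡⟨ completions-swap n _ _ ⟩
  G n                           ∎
  where open ≡-Reasoning

-- Comparison with walks in T

-- Z = q (1 + q G): the weight that a walk back to v₁ contributes by turning
-- there, after which all choices are open again.
Z : Series
Z 0             = 0ℤ
Z 1             = 1ℤ
Z (suc (suc n)) = + G n

-- `value u` counts the continuations from a state at `u`: those that follow `T` to the end, and
-- those that reach `v₁` and leave `T` there, the remaining steps being weighted by `Z`.
arrivals departures value : Vertex → Series
arrivals   u = genFun λ n → card (WalkTo-v₁-finite n u)
departures u = genFun λ n → card (WalkFrom-finite n u)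
value u = departures u + arrivals u * Z

value-zero : ∀ u → value u 0 ≡ 1ℤ
value-zero u = cong (λ x → 1ℤ ℤ.+ x) (ℤ.*-zeroʳ (arrivals u 0))

-- The empty walk from `v₁` to itself contributes the extra `Z (suc n)`, which stands in for the
-- second outgoing edge that `main 0` does not have.
value-root : ∀ n → value (main 0) (suc n) ≡ value (main 1) n ℤ.+ Z (suc n)
value-root n = regroup (departures (main 1) n) (Z (suc n)) _
  where
  regroup : ∀ a b c → a ℤ.+ (1ℤ ℤ.* b ℤ.+ c) ≡ (a ℤ.+ c) ℤ.+ b
  regroup = ℤ-Solver.solve-∀

value-main : ∀ l n → value (main (suc l)) (suc n) ≡ value (main (2 ℕ.+ l)) n ℤ.+ value (return l (fromℕ (suc l))) n
value-main l n = trans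
  (cong (λ x → departures (main (suc l)) (suc n) ℤ.+ (0ℤ ℤ.* Z (suc n) ℤ.+ x))
        (*-distribʳ-+ Z (arrivals (main (2 ℕ.+ l))) (arrivals (return l (fromℕ (suc l)))) n))
  (regroup (departures (main (2 ℕ.+ l)) n) (departures (return l (fromℕ (suc l))) n) (Z (suc n))
    ((arrivals (main (2 ℕ.+ l)) * Z) n) ((arrivals (return l (fromℕ (suc l))) * Z) n))
  where
  regroup : ∀ a b z c d → (a ℤ.+ b) ℤ.+ (0ℤ ℤ.* z ℤ.+ (c ℤ.+ d)) ≡ (a ℤ.+ c) ℤ.+ (b ℤ.+ d)
  regroup = ℤ-Solver.solve-∀

drop-zero : ∀ a z c → a ℤ.+ (0ℤ ℤ.* z ℤ.+ c) ≡ a ℤ.+ c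
drop-zero = ℤ-Solver.solve-∀

value-down : ∀ l i n → value (return l (suc i)) (suc n) ≡ value (return l (inject₁ i)) n
value-down l i n = drop-zero (departures (return l (inject₁ i)) n) (Z (suc n)) ((arrivals (return l (inject₁ i)) * Z) n)

value-enter : ∀ l n → value (return l zero) (suc n) ≡ value (main l) n
value-enter l n = drop-zero (departures (main l) n) (Z (suc n)) ((arrivals (main l) * Z) n)

-- Being at main l means that the last l + 2 minima went to the same end and that
-- the other end is open.  Switching from main (l + 1) to the other end creates
-- the gap l + 4 there; hence the next minimum must go back, and the following
-- ones must stay until that gap is admissible again.  Including the switch, this
-- takes as many minima as the return path to main l has edges, namely l + 3.
data Simulates : Vertex → End → End → Set where
  running : ∀ {l g h} → g ≤ 2 → h ≤ 4 ℕ.+ l → Simulates (main l) (0 , g) (2 ℕ.+ l , h)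
  turning : ∀ {l i g} → toℕ i ≡ suc l → g ≤ 2 → Simulates (return l i) (0 , 4 ℕ.+ l) (1 , g)
  forced  : ∀ {l i c g} → toℕ i ℕ.+ suc c ≡ suc l → g ≤ 2 →
            Simulates (return l i) (0 , g) (suc c , 4 ℕ.+ l)

simulates : ∀ n {u l r} → Simulates u l r → + completions n l r ≡ value u n
simulates zero {u} s = sym (value-zero u)
simulates (suc n) (running {zero} {g} {h} g≤2 h≤4) = begin
  + completions (suc n) (0 , g) (2 , h)
    ≡⟨ cong +_ (completions-both n g≤2 h≤4) ⟩
  + completions n (0 , 1) (3 , h) ℤ.+ + completions n (0 , 3) (1 , g)
    ≡⟨ cong₂ ℤ._+_ (simulates n (running (s≤s z≤n) (ℕ.m≤n⇒m≤1+n h≤4))) (turn n) ⟩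
  value (main 1) n ℤ.+ Z (suc n)
    ≡⟨ value-root n ⟨
  value (main 0) (suc n) ∎
  where
  open ≡-Reasoning
  -- Turning at `v₁` creates the gap 3 at value 0, one above the bound. A single forced step back
  -- buries it to value 1, where it is admissible, and everything is open again.
  turn : ∀ n → + completions n (0 , 3) (1 , g) ≡ Z (suc n)
  turn zero    = refl
  turn (suc n) = cong +_ (trans
    (completions-right n (λ { (s≤s (s≤s ())) }) (ℕ.m≤n⇒m≤1+n g≤2))
    (open-completions n ℕ.≤-refl ℕ.≤-refl))
simulates (suc n) (running {suc l} {g} {h} g≤2 h≤) = begin
  + completions (suc n) (0 , g) (3 ℕ.+ l , h)
    ≡⟨ cong +_ (completions-both n g≤2 h≤) ⟩
  + completions n (0 , 1) (4 ℕ.+ l , h) ℤ.+ + completions n (0 , 4 ℕ.+ l) (1 , g)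
    ≡⟨ cong₂ ℤ._+_ (simulates n (running (s≤s z≤n) (ℕ.m≤n⇒m≤1+n h≤)))
                   (simulates n (turning (Fin.toℕ-fromℕ (suc l)) g≤2)) ⟩
  value (main (2 ℕ.+ l)) n ℤ.+ value (return l (fromℕ (suc l))) n
    ≡⟨ value-main l n ⟨
  value (main (suc l)) (suc n) ∎
  where open ≡-Reasoning
simulates (suc n) (turning {l} {suc i} {g} i≡l g≤2) = begin
  + completions (suc n) (0 , 4 ℕ.+ l) (1 , g)
    ≡⟨ cong +_ (completions-right n (λ { (s≤s (s≤s ())) }) (ℕ.m≤n⇒m≤1+n g≤2)) ⟩
  + completions n (0 , 2) (1 , 4 ℕ.+ l)
    -- The forced phase starts with `c` = 0. Each further minimum lowers `i` and raises `c` by one,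
    -- so the sum in `forced` is invariant.
    ≡⟨ simulates n (forced (trans (cong (ℕ._+ 1) (Fin.toℕ-inject₁ i)) (trans (ℕ.+-comm _ 1) i≡l)) ℕ.≤-refl) ⟩
  value (return l (inject₁ i)) n
    ≡⟨ value-down l i n ⟨
  value (return l (suc i)) (suc n) ∎
  where open ≡-Reasoning
simulates (suc n) (forced {l} {i} {c} {g} i+c≡l g≤2) = begin
  + completions (suc n) (0 , g) (suc c , 4 ℕ.+ l)
    ≡⟨ cong +_ (completions-left n g≤2 closed) ⟩
  + completions n (0 , 1) (2 ℕ.+ c , 4 ℕ.+ l)
    ≡⟨ next i i+c≡l ⟩
  value (return l i) (suc n) ∎
  where
  open ≡-Reasoning
  closed : ¬ Open (suc c , 4 ℕ.+ l)
  -- Openness would need `c` above `l`, while the invariant bounds `suc c` by `suc l`.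
  closed (s≤s (s≤s (s≤s l<c))) =
    ℕ.<⇒≱ l<c (ℕ.s≤s⁻¹ (ℕ.≤-trans (ℕ.m≤n+m (suc c) (toℕ i)) (ℕ.≤-reflexive i+c≡l)))
  next : ∀ i → toℕ i ℕ.+ suc c ≡ suc l → + completions n (0 , 1) (2 ℕ.+ c , 4 ℕ.+ l) ≡ value (return l i) (suc n)
  -- Here `c` is `l`, so the buried value becomes `2 + l`, the first one for which the gap `4 + l`
  -- is admissible.
  next zero    refl = trans (simulates n (running (s≤s z≤n) ℕ.≤-refl)) (sym (value-enter l n))
  next (suc i) i+c≡l = trans
    (simulates n (forced (trans (cong (ℕ._+ suc (suc c)) (Fin.toℕ-inject₁ i)) (trans (ℕ.+-suc (toℕ i) (suc c)) i+c≡l)) (s≤s z≤n)))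
    (sym (value-down l i n))

-- Both ends are open in the state of `G`. Using the same end again enters `T` at `v₁`; switching
-- ends keeps all choices open.
G-suc : ∀ n → + G (suc n) ≡ value v₁ n ℤ.+ + G n
G-suc n = begin
  + G (suc n)
    ≡⟨ cong +_ (completions-both n (s≤s z≤n) z≤n) ⟩
  + completions n (0 , 1) (2 , 0) ℤ.+ + completions n (0 , 2) (1 , 1)
    ≡⟨ cong₂ ℤ._+_ (simulates n (running (s≤s z≤n) z≤n)) (cong +_ (open-completions n ℕ.≤-refl (s≤s z≤n))) ⟩
  value v₁ n ℤ.+ + G n ∎
  where open ≡-Reasoning

-- 1-convex permutations as sequences of choices

-- This frees `f₁` from the particular enumeration used to define it.
card-unique : ∀ {S} (F F′ : Finite S) → card F ≡ card F′
card-unique (finite _ e) (finite _ e′) = ↔⇒≡ (Compose.inverse e (Symmetry.inverse e′))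

-- OneConvex without integers: the subtracted term is moved to the other side.
Convex : ∀ {n} → (Fin n → Fin n) → Set
Convex {n} f = ∀ (i j k : Fin n) → toℕ j ≡ suc (toℕ i) → toℕ k ≡ suc (toℕ j) →
  toℕ (f i) ℕ.+ toℕ (f k) ≤ 1 ℕ.+ 2 ℕ.* toℕ (f j)

pos-2* : ∀ n → (+ 2) ℤ.* + n ≡ + (2 ℕ.* n)
pos-2* n = sym (ℤ.pos-* 2 n)

OneConvex⇒Convex : ∀ {n} (f : Fin n → Fin n) → OneConvex f → Convex f
OneConvex⇒Convex f c i j k p r = ℤ.drop‿+≤+ (subst₂ ℤ._≤_
  (cancel _ (+ 2 ℤ.* + toℕ (f j))) (cong (λ x → 1ℤ ℤ.+ x) (pos-2* (toℕ (f j))))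
  (ℤ.+-monoˡ-≤ (+ 2 ℤ.* + toℕ (f j)) (c i j k p r)))
  where
  cancel : ∀ a b → a ℤ.- b ℤ.+ b ≡ a
  cancel = ℤ-Solver.solve-∀

Convex⇒OneConvex : ∀ {n} (f : Fin n → Fin n) → Convex f → OneConvex f
Convex⇒OneConvex f c i j k p r = subst₂ ℤ._≤_
  (cong (λ x → + (toℕ (f i) ℕ.+ toℕ (f k)) ℤ.- x) (sym (pos-2* (toℕ (f j))))) (cancel (+ (2 ℕ.* toℕ (f j))))
  (ℤ.+-monoˡ-≤ (ℤ.- + (2 ℕ.* toℕ (f j))) (ℤ.+≤+ (c i j k p r)))
  where
  cancel : ∀ a → (1ℤ ℤ.+ a) ℤ.- a ≡ 1ℤ
  cancel = ℤ-Solver.solve-∀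

Convex-resp : ∀ {n} {f g : Fin n → Fin n} → f ≗ g → Convex f → Convex g
Convex-resp f≗g c i j k p r with c i j k p r
... | r rewrite f≗g i | f≗g j | f≗g k = r

opposite-pred : ∀ {n} {i j : Fin n} → toℕ j ≡ suc (toℕ i) → toℕ (opposite i) ≡ suc (toℕ (opposite j))
opposite-pred {n} {i} {j} j≡1+i = begin
  toℕ (opposite i)            ≡⟨ Fin.opposite-prop i ⟩
  n ℕ.∸ suc (toℕ i)           ≡⟨ cong (n ℕ.∸_) j≡1+i ⟨
  n ℕ.∸ toℕ j                 ≡⟨ ℕ.+-∸-assoc 1 (Fin.toℕ<n j) ⟩
  suc (n ℕ.∸ suc (toℕ j))     ≡⟨ cong suc (Fin.opposite-prop j) ⟨
  suc (toℕ (opposite j))      ∎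
  where open ≡-Reasoning

Convex-opposite : ∀ {n} (f : Fin n → Fin n) → Convex f → Convex (f ∘ opposite)
Convex-opposite f c i j k j≡ k≡ = subst (_≤ 1 ℕ.+ 2 ℕ.* toℕ (f (opposite j)))
  (ℕ.+-comm (toℕ (f (opposite k))) _)
  (c (opposite k) (opposite j) (opposite i) (opposite-pred k≡) (opposite-pred j≡))

-- Ends of a permutation and insertion of a new minimum

leftEnd : ∀ {n} → (Fin (suc n) → Fin (suc n)) → End
leftEnd {zero}  f = toℕ (f zero) , 0
leftEnd {suc n} f = toℕ (f zero) , toℕ (f (suc zero)) ℕ.∸ toℕ (f zero)

rightEnd : ∀ {n} → (Fin (suc n) → Fin (suc n)) → End
rightEnd f = leftEnd (f ∘ opposite)

leftEnd-cong : ∀ {n} {f g : Fin (suc n) → Fin (suc n)} → f ≗ g → leftEnd f ≡ leftEnd g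
leftEnd-cong {zero}  f≗g = cong (λ x → toℕ x , 0) (f≗g zero)
leftEnd-cong {suc n} f≗g = cong₂ (λ x y → toℕ x , toℕ y ℕ.∸ toℕ x) (f≗g zero) (f≗g (suc zero))

opposite-cancel : ∀ {n} {A : Set} {f g : Fin n → A} → f ∘ opposite ≗ g ∘ opposite → f ≗ g
opposite-cancel {f = f} {g} eq i = begin
  f i                       ≡⟨ cong f (Fin.opposite-involutive i) ⟨
  f (opposite (opposite i)) ≡⟨ eq (opposite i) ⟩
  g (opposite (opposite i)) ≡⟨ cong g (Fin.opposite-involutive i) ⟩
  g i                       ∎
  where open ≡-Reasoning

rightEnd-opposite : ∀ {n} (f : Fin (suc n) → Fin (suc n)) → rightEnd (f ∘ opposite) ≡ leftEnd f
rightEnd-opposite f = leftEnd-cong (cong f ∘ Fin.opposite-involutive)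

-- `lift₀` puts a new smallest value in front and raises all others by one. `appendMin` reverses
-- positions before and after, which reduces statements about right ends to left ends.
prependMin appendMin : ∀ {n} → Permutation′ (suc n) → Permutation′ (suc (suc n))
prependMin π = lift₀ π
appendMin  π = reverse ∘ₚ prependMin (reverse ∘ₚ π)

appendMin-injective : ∀ {n} (π ρ : Permutation′ (suc n)) →
  (appendMin π ⟨$⟩ʳ_) ≗ (appendMin ρ ⟨$⟩ʳ_) → (π ⟨$⟩ʳ_) ≗ (ρ ⟨$⟩ʳ_)
appendMin-injective π ρ eq = opposite-cancel λ i → Fin.suc-injective
  (opposite-cancel {f = prependMin (reverse ∘ₚ π) ⟨$⟩ʳ_} {prependMin (reverse ∘ₚ ρ) ⟨$⟩ʳ_} eq (suc i))

leftEnd-prependMin : ∀ {n} (π : Permutation′ (suc n)) →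
  leftEnd (prependMin π ⟨$⟩ʳ_) ≡ extend (leftEnd (π ⟨$⟩ʳ_))
leftEnd-prependMin {zero}  π = refl
leftEnd-prependMin {suc n} π = refl

rightEnd-prependMin : ∀ {n} (π : Permutation′ (suc n)) →
  rightEnd (prependMin π ⟨$⟩ʳ_) ≡ bury (rightEnd (π ⟨$⟩ʳ_))
rightEnd-prependMin {zero}  π = refl
rightEnd-prependMin {suc n} π = refl

suc+suc : ∀ a c → suc a ℕ.+ suc c ≡ 2 ℕ.+ (a ℕ.+ c)
suc+suc = solve-∀

1+2*suc : ∀ b → 1 ℕ.+ 2 ℕ.* suc b ≡ 2 ℕ.+ (1 ℕ.+ 2 ℕ.* b)
1+2*suc = solve-∀

1+2*suc′ : ∀ a → 1 ℕ.+ 2 ℕ.* suc a ≡ suc (a ℕ.+ (2 ℕ.+ a))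
1+2*suc′ = solve-∀

-- For triples of old positions both sides of the inequality grow by 2. The only new triple is the
-- leftmost one, and its inequality is openness of the left end.
prependMin-convex : ∀ {n} (π : Permutation′ (suc n)) →
  Convex (π ⟨$⟩ʳ_) → Open (leftEnd (π ⟨$⟩ʳ_)) → Convex (prependMin π ⟨$⟩ʳ_)
prependMin-convex π c o (suc i) (suc j) (suc k) p r =
  subst₂ _≤_ (sym (suc+suc _ (toℕ (π ⟨$⟩ʳ k)))) (sym (1+2*suc (toℕ (π ⟨$⟩ʳ j))))
    (s≤s (s≤s (c i j k (ℕ.suc-injective p) (ℕ.suc-injective r))))
prependMin-convex {suc n} π c o zero (suc zero) (suc (suc zero)) _ _ =
  ℕ.≤-trans (s≤s (ℕ.≤-trans (ℕ.m≤n+m∸n b a) (ℕ.+-monoʳ-≤ a o))) (ℕ.≤-reflexive (sym (1+2*suc′ a)))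
  where
  a = toℕ (π ⟨$⟩ʳ zero)
  b = toℕ (π ⟨$⟩ʳ suc zero)

prependMin-convex⁻¹ : ∀ {n} (π : Permutation′ (suc n)) →
  Convex (prependMin π ⟨$⟩ʳ_) → Convex (π ⟨$⟩ʳ_) × Open (leftEnd (π ⟨$⟩ʳ_))
prependMin-convex⁻¹ {n} π c =
  (λ i j k p r → ℕ.s≤s⁻¹ (ℕ.s≤s⁻¹ (subst₂ _≤_ (suc+suc _ (toℕ (π ⟨$⟩ʳ k))) (1+2*suc (toℕ (π ⟨$⟩ʳ j)))
    (c (suc i) (suc j) (suc k) (cong suc p) (cong suc r))))) ,
  isOpen n π c
  where
  isOpen : ∀ n (π : Permutation′ (suc n)) → Convex (prependMin π ⟨$⟩ʳ_) → Open (leftEnd (π ⟨$⟩ʳ_))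
  isOpen zero    π c = z≤n
  isOpen (suc n) π c = ℕ.m≤n+o⇒m∸n≤o b a
    (ℕ.s≤s⁻¹ (ℕ.≤-trans (c zero (suc zero) (suc (suc zero)) refl refl) (ℕ.≤-reflexive (1+2*suc′ a))))
    where
    a = toℕ (π ⟨$⟩ʳ zero)
    b = toℕ (π ⟨$⟩ʳ suc zero)

-- Removal of the minimum

⟨$⟩ʳ-injective : ∀ {n} (π : Permutation′ n) {i j} → π ⟨$⟩ʳ i ≡ π ⟨$⟩ʳ j → i ≡ j
⟨$⟩ʳ-injective π eq = trans (sym (inverseˡ π)) (trans (cong (π ⟨$⟩ˡ_) eq) (inverseˡ π))

-- Strictly inside, the neighbours of a zero would have values of sum at least 2.
min-at-end : ∀ {n} (π : Permutation′ (suc n)) → Convex (π ⟨$⟩ʳ_) →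
  π ⟨$⟩ʳ zero ≡ zero ⊎ π ⟨$⟩ʳ fromℕ n ≡ zero
min-at-end {n} π c = locate (π ⟨$⟩ˡ zero) (inverseʳ π)
  where
  value≢0 : ∀ {i j} → π ⟨$⟩ʳ j ≡ zero → i ≢ j → 1 ≤ toℕ (π ⟨$⟩ʳ i)
  value≢0 {i} {j} πj≡0 i≢j = ℕ.n≢0⇒n>0 λ πi≡0 →
    i≢j (⟨$⟩ʳ-injective π (trans (Fin.toℕ-injective πi≡0) (sym πj≡0)))

  locate : ∀ j → π ⟨$⟩ʳ j ≡ zero → π ⟨$⟩ʳ zero ≡ zero ⊎ π ⟨$⟩ʳ fromℕ n ≡ zero
  locate zero    πj≡0 = inj₁ πj≡0
  locate (suc i) πj≡0 with suc (toℕ i) ℕ.≟ n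
  ... | yes j≡n = inj₂ (trans (cong (π ⟨$⟩ʳ_) (Fin.toℕ-injective (trans (Fin.toℕ-fromℕ n) (sym j≡n)))) πj≡0)
  ... | no  j≢n = contradiction interior λ { (s≤s ()) }
    where
    open ℕ.≤-Reasoning
    j k h : Fin (suc n)
    h = inject₁ i
    j = suc i
    j<n = s≤s (ℕ.≤∧≢⇒< (Fin.toℕ<n i) j≢n)
    k = fromℕ< j<n
    k≡1+j : toℕ k ≡ suc (toℕ j)
    k≡1+j = Fin.toℕ-fromℕ< j<n
    j≡1+h : toℕ j ≡ suc (toℕ h)
    j≡1+h = cong suc (sym (Fin.toℕ-inject₁ i))
    interior : 2 ≤ 1
    interior = begin
      1 ℕ.+ 1                             ≤⟨ ℕ.+-mono-≤ (value≢0 πj≡0 λ h≡j → ℕ.1+n≢n (trans (sym j≡1+h) (cong toℕ (sym h≡j))))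
                                                         (value≢0 πj≡0 λ k≡j → ℕ.1+n≢n (trans (sym k≡1+j) (cong toℕ k≡j))) ⟩
      toℕ (π ⟨$⟩ʳ h) ℕ.+ toℕ (π ⟨$⟩ʳ k) ≤⟨ c h j k j≡1+h k≡1+j ⟩
      1 ℕ.+ 2 ℕ.* toℕ (π ⟨$⟩ʳ j)         ≡⟨ cong (λ x → 1 ℕ.+ 2 ℕ.* toℕ x) πj≡0 ⟩
      1                                   ∎

remove-min : ∀ {n} (π : Permutation′ (suc (suc n))) → Convex (π ⟨$⟩ʳ_) → π ⟨$⟩ʳ zero ≡ zero →
  ∃ λ τ → (prependMin τ ⟨$⟩ʳ_) ≗ (π ⟨$⟩ʳ_) × Convex (τ ⟨$⟩ʳ_) × Open (leftEnd (τ ⟨$⟩ʳ_))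
remove-min π c π0≡0 = remove zero π , τ≗π
  , prependMin-convex⁻¹ (remove zero π) (Convex-resp (λ i → sym (τ≗π i)) c)
  where
  τ≗π : (prependMin (remove zero π) ⟨$⟩ʳ_) ≗ (π ⟨$⟩ʳ_)
  τ≗π = lift₀-remove π π0≡0

-- A history lists the choices already made, the latest one outermost; a future
-- lists the choices to come, the next one outermost.
data History : ℕ → End → End → Set where
  start : History 0 (0 , 0) (0 , 0)
  left  : ∀ {n l r} → Open l → History n l r → History (suc n) (extend l) (bury r)
  right : ∀ {n l r} → Open r → History n l r → History (suc n) (bury l) (extend r)

⟦_⟧ : ∀ {n l r} → History n l r → Permutation′ (suc n)
⟦ start ⟧     = id
⟦ left  _ h ⟧ = prependMin ⟦ h ⟧
⟦ right _ h ⟧ = appendMin ⟦ h ⟧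

⟦⟧-ends : ∀ {n l r} (h : History n l r) → leftEnd (⟦ h ⟧ ⟨$⟩ʳ_) ≡ l × rightEnd (⟦ h ⟧ ⟨$⟩ʳ_) ≡ r
⟦⟧-ends start = refl , refl
⟦⟧-ends (left _ h) =
  trans (leftEnd-prependMin ⟦ h ⟧) (cong extend (proj₁ (⟦⟧-ends h))) ,
  trans (rightEnd-prependMin ⟦ h ⟧) (cong bury (proj₂ (⟦⟧-ends h)))
⟦⟧-ends (right _ h) =
  trans (rightEnd-prependMin (reverse ∘ₚ ⟦ h ⟧))
    (cong bury (trans (rightEnd-opposite (⟦ h ⟧ ⟨$⟩ʳ_)) (proj₁ (⟦⟧-ends h)))) ,
  trans (rightEnd-opposite (prependMin (reverse ∘ₚ ⟦ h ⟧) ⟨$⟩ʳ_))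
    (trans (leftEnd-prependMin (reverse ∘ₚ ⟦ h ⟧)) (cong extend (proj₂ (⟦⟧-ends h))))

⟦⟧-convex : ∀ {n l r} (h : History n l r) → Convex (⟦ h ⟧ ⟨$⟩ʳ_)
⟦⟧-convex start zero zero _ ()
⟦⟧-convex (left o h) =
  prependMin-convex ⟦ h ⟧ (⟦⟧-convex h) (subst Open (sym (proj₁ (⟦⟧-ends h))) o)
⟦⟧-convex (right o h) = Convex-opposite (prependMin (reverse ∘ₚ ⟦ h ⟧) ⟨$⟩ʳ_)
  (prependMin-convex (reverse ∘ₚ ⟦ h ⟧) (Convex-opposite (⟦ h ⟧ ⟨$⟩ʳ_) (⟦⟧-convex h))
     (subst Open (sym (proj₂ (⟦⟧-ends h))) o))

Histories : ℕ → Set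
Histories n = ∃ λ l → ∃ λ r → History n l r

-- Histories are counted up to propositional equality, so their openness proofs must agree too; this
-- is irrelevance of `≤`.
⟦⟧-injective : ∀ {n l r l′ r′} (h : History n l r) (h′ : History n l′ r′) →
  (⟦ h ⟧ ⟨$⟩ʳ_) ≗ (⟦ h′ ⟧ ⟨$⟩ʳ_) → _≡_ {A = Histories n} (l , r , h) (l′ , r′ , h′)
⟦⟧-injective start start _ = refl
⟦⟧-injective (left o h) (left o′ h′) eq
  with refl ← ⟦⟧-injective h h′ (λ i → Fin.suc-injective (eq (suc i))) =
  cong (λ o → _ , _ , left o h) (ℕ.≤-irrelevant o o′)
⟦⟧-injective (right o h) (right o′ h′) eq
  with refl ← ⟦⟧-injective h h′ (appendMin-injective ⟦ h ⟧ ⟦ h′ ⟧ eq) =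
  cong (λ o → _ , _ , right o h) (ℕ.≤-irrelevant o o′)
-- A prepended minimum gives the first position the value 0, an appended one leaves a positive value
-- there.
⟦⟧-injective (left _ _) (right _ _) eq with () ← eq zero
⟦⟧-injective (right _ _) (left _ _) eq with () ← eq zero

Realised : ∀ {n} → Permutation′ (suc n) → Set
Realised {n} π = ∃ λ ((_ , _ , h) : Histories n) → (⟦ h ⟧ ⟨$⟩ʳ_) ≗ (π ⟨$⟩ʳ_)

prepend-realised : ∀ {n} (τ : Permutation′ (suc n)) π →
  (prependMin τ ⟨$⟩ʳ_) ≗ (π ⟨$⟩ʳ_) → Open (leftEnd (τ ⟨$⟩ʳ_)) → Realised τ → Realised π
prepend-realised τ π τ≗π o ((_ , _ , h) , h≗τ) =
  (_ , _ , left (subst Open (trans (sym (leftEnd-cong h≗τ)) (proj₁ (⟦⟧-ends h))) o) h) ,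
  λ i → trans (lift₀-cong ⟦ h ⟧ τ h≗τ i) (τ≗π i)

append-realised : ∀ {n} (τ : Permutation′ (suc n)) π →
  (prependMin τ ⟨$⟩ʳ_) ≗ (reverse ∘ₚ π ⟨$⟩ʳ_) → Open (leftEnd (τ ⟨$⟩ʳ_)) →
  Realised (reverse ∘ₚ τ) → Realised π
append-realised τ π τ≗π o ((_ , _ , h) , h≗τ) =
  (_ , _ , right (subst Open (trans (sym (leftEnd-cong reversed)) (proj₂ (⟦⟧-ends h))) o) h) ,
  opposite-cancel {f = appendMin ⟦ h ⟧ ⟨$⟩ʳ_} {π ⟨$⟩ʳ_} λ i → trans
    (cong (prependMin (reverse ∘ₚ ⟦ h ⟧) ⟨$⟩ʳ_) (Fin.opposite-involutive i))
    (trans (lift₀-cong (reverse ∘ₚ ⟦ h ⟧) τ reversed i) (τ≗π i))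
  where
  reversed : ∀ i → ⟦ h ⟧ ⟨$⟩ʳ opposite i ≡ τ ⟨$⟩ʳ i
  reversed i = trans (h≗τ (opposite i)) (cong (τ ⟨$⟩ʳ_) (Fin.opposite-involutive i))

-- The end that holds the minimum reveals the latest choice; removing it leaves a shorter convex
-- permutation for the induction.
⟦⟧-surjective : ∀ {n} (π : Permutation′ (suc n)) → Convex (π ⟨$⟩ʳ_) → Realised π
⟦⟧-surjective {zero} π _ = (_ , _ , start) ,
  λ i → Fin.toℕ-injective (trans (below-1 i) (sym (below-1 (π ⟨$⟩ʳ i))))
  where
  below-1 : ∀ (i : Fin 1) → toℕ i ≡ 0
  below-1 zero = refl
⟦⟧-surjective {suc n} π c with min-at-end π c
... | inj₁ π0≡0 =
  let τ , τ≗ , c′ , o = remove-min π c π0≡0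
  in prepend-realised τ π τ≗ o (⟦⟧-surjective τ c′)
... | inj₂ πn≡0 =
  let τ , τ≗ , c′ , o = remove-min (reverse ∘ₚ π) (Convex-opposite (π ⟨$⟩ʳ_) c) πn≡0
  in append-realised τ π τ≗ o (⟦⟧-surjective (reverse ∘ₚ τ) (Convex-opposite (τ ⟨$⟩ʳ_) c′))

Histories↔ : ∀ n → Inverse (setoid (Histories n)) (OneConvexPermutation (suc n))
Histories↔ n = Bijection⇒Inverse record
  { to        = λ (_ , _ , h) → ⟦ h ⟧ , Convex⇒OneConvex (⟦ h ⟧ ⟨$⟩ʳ_) (⟦⟧-convex h)
  ; cong      = λ { refl _ → refl }
  ; bijective = (λ {x} {y} → ⟦⟧-injective (proj₂ (proj₂ x)) (proj₂ (proj₂ y)))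
              , λ (π , c) → let h , h≗π = ⟦⟧-surjective π (OneConvex⇒Convex (π ⟨$⟩ʳ_) c) in h , λ { refl → h≗π }
  }

-- Counting histories by way of futures

data Future : ℕ → End → End → Set where
  done  : ∀ {l r} → Future 0 l r
  left  : ∀ {n l r} → Open l → Future n (extend l) (bury r) → Future (suc n) l r
  right : ∀ {n l r} → Open r → Future n (bury l) (extend r) → Future (suc n) l r

when-↔ : ∀ {A B : Set} {k} (a? : Dec A) → Irrelevant A → Fin k ↔ B → Fin (when a? k) ↔ (A × B)
when-↔ (yes a) irr k↔B = mk↔ₛ′ (λ i → a , to i) (λ (_ , b) → from b)
  (λ (a′ , b) → cong₂ _,_ (irr a a′) (strictlyInverseˡ b)) strictlyInverseʳ
  where open Inverse k↔B
when-↔ (no ¬a) irr k↔B = mk↔ₛ′ (λ ()) (λ (a , _) → contradiction a ¬a)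
  (λ (a , _) → contradiction a ¬a) (λ ())

completions-↔ : ∀ n l r → Fin (completions n l r) ↔ Future n l r
completions-↔ zero    l r = mk↔ₛ′ (λ _ → done) (λ _ → zero) (λ { done → refl }) (λ { zero → refl })
completions-↔ (suc n) l r =
  Compose.inverse (Fin.+↔⊎ {when (open? l) _} {when (open? r) _})
    (Compose.inverse
      (when-↔ (open? l) ℕ.≤-irrelevant (completions-↔ n (extend l) (bury r)) ⊎-↔
       when-↔ (open? r) ℕ.≤-irrelevant (completions-↔ n (bury l) (extend r)))
      (mk↔ₛ′ (λ { (inj₁ (o , w)) → left o w ; (inj₂ (o , w)) → right o w })
             (λ { (left o w) → inj₁ (o , w) ; (right o w) → inj₂ (o , w) })
             (λ { (left _ _) → refl ; (right _ _) → refl })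
             (λ { (inj₁ _) → refl ; (inj₂ _) → refl })))

-- A sequence of choices cut at an intermediate state. Moving the cut turns futures, which match the
-- recursion of `completions`, into histories, which match permutations.
Zipper : ℕ → ℕ → Set
Zipper n m = ∃ λ l → ∃ λ r → History n l r × Future m l r

step-↔ : ∀ n m → Zipper n (suc m) ↔ Zipper (suc n) m
step-↔ n m = mk↔ₛ′
  (λ { (_ , _ , h , left o w) → _ , _ , left o h , w ; (_ , _ , h , right o w) → _ , _ , right o h , w })
  (λ { (_ , _ , left o h , w) → _ , _ , h , left o w ; (_ , _ , right o h , w) → _ , _ , h , right o w })
  (λ { (_ , _ , left _ _ , _) → refl ; (_ , _ , right _ _ , _) → refl })
  (λ { (_ , _ , _ , left _ _) → refl ; (_ , _ , _ , right _ _) → refl })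

play-↔ : ∀ m n → Zipper n m ↔ Histories (m ℕ.+ n)
play-↔ zero n = mk↔ₛ′ (λ (_ , _ , h , _) → _ , _ , h) (λ (_ , _ , h) → _ , _ , h , done)
  (λ _ → refl) (λ { (_ , _ , _ , done) → refl })
play-↔ (suc m) n = Compose.inverse (step-↔ n m)
  (subst (λ k → Zipper (suc n) m ↔ Histories k) (ℕ.+-suc m n) (play-↔ m (suc n)))

start-↔ : ∀ m → Future m (0 , 0) (0 , 0) ↔ Zipper 0 m
start-↔ m = mk↔ₛ′ (λ w → _ , _ , start , w) (λ { (_ , _ , start , w) → w })
  (λ { (_ , _ , start , w) → refl }) (λ _ → refl)

f₁-suc : ∀ n → f₁ (suc n) ≡ completions n (0 , 0) (0 , 0)
f₁-suc n = card-unique (OneConvexPermutation-finite (suc n)) (finite _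
  (Compose.inverse (completions-↔ n _ _)
    (Compose.inverse (start-↔ n)
      (Compose.inverse (subst (λ k → Zipper 0 n ↔ Histories k) (ℕ.+-identityʳ n) (play-↔ n 0))
        (Histories↔ n)))))

-- From a single value, the two choices for the next minimum lead to mirror-image states.
f₁-suc-suc : ∀ n → f₁ (2 ℕ.+ n) ≡ 2 ℕ.* G n
f₁-suc-suc n = begin
  f₁ (2 ℕ.+ n)                              ≡⟨ f₁-suc (suc n) ⟩
  G n ℕ.+ completions n (1 , 0) (0 , 1)     ≡⟨ cong (G n ℕ.+_) (completions-swap n _ _) ⟩
  G n ℕ.+ G n                               ≡⟨ cong (G n ℕ.+_) (ℕ.+-identityʳ (G n)) ⟨
  2 ℕ.* G n                                 ∎
  where open ≡-Reasoning

-- The generating function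

numerator : Series
numerator = const 1ℤ + bot * q ^ 2 + tot * q

denominator-tail : tail (tail (tail denominator)) ≈ bot
denominator-tail n = begin
  0ℤ ℤ.+ 0ℤ ℤ.+ (bot * q ^ 3) (3 ℕ.+ n) ≡⟨ ℤ.+-identityˡ _ ⟩
  (bot * q ^ 3) (3 ℕ.+ n)               ≡⟨ *-q-suc bot (q ^ 2) (2 ℕ.+ n) ⟩
  (bot * q ^ 2) (2 ℕ.+ n)               ≡⟨ *-q-suc bot (q ^ 1) (1 ℕ.+ n) ⟩
  (bot * q ^ 1) (1 ℕ.+ n)               ≡⟨ *-q-suc bot (const 1ℤ) n ⟩
  (bot * const 1ℤ) n                    ≡⟨ *-identityʳ bot n ⟩
  bot n                                 ∎
  where open ≡-Reasoning

numerator-tail : ∀ n → numerator (2 ℕ.+ n) ≡ bot n ℤ.+ tot (suc n)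
numerator-tail n = cong₂ ℤ._+_
  (begin
    0ℤ ℤ.+ (bot * q ^ 2) (2 ℕ.+ n) ≡⟨ ℤ.+-identityˡ _ ⟩
    (bot * q ^ 2) (2 ℕ.+ n)        ≡⟨ *-q-suc bot (q ^ 1) (1 ℕ.+ n) ⟩
    (bot * q ^ 1) (1 ℕ.+ n)        ≡⟨ *-q-suc bot (const 1ℤ) n ⟩
    (bot * const 1ℤ) n             ≡⟨ *-identityʳ bot n ⟩
    bot n                          ∎)
  (begin
    (tot * q) (2 ℕ.+ n)            ≡⟨ *-comm tot q (2 ℕ.+ n) ⟩
    (q * tot) (2 ℕ.+ n)            ≡⟨ q-*-suc tot (suc n) ⟩
    tot (suc n)                    ∎)
  where open ≡-Reasoning

-- This is the recurrence `G-suc` cleared of `Z`. Degrees 0 to 2 are evaluated directly, because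
-- `bot` enters the denominator only from degree 3.
-G-*-denominator : (λ n → ℤ.- (+ G n)) * denominator ≈ numerator
-G-*-denominator zero                = refl
-G-*-denominator (suc zero)          = refl
-G-*-denominator (suc (suc zero))    = refl
-G-*-denominator (suc (suc (suc n))) = begin
  (-G * denominator) (3 ℕ.+ n)
    ≡⟨ *-comm -G denominator (3 ℕ.+ n) ⟩
  combine (+ G (3 ℕ.+ n)) ((tail (tail (tail denominator)) * -G) n)
    ≡⟨ cong₂ combine (G-suc (2 ℕ.+ n)) product ⟩
  combine (tot (2 ℕ.+ n) ℤ.+ (bot * Z) (2 ℕ.+ n) ℤ.+ + G (2 ℕ.+ n)) (ℤ.- c)
    ≡⟨ cong (λ x → combine (tot (2 ℕ.+ n) ℤ.+ x ℤ.+ + G (2 ℕ.+ n)) (ℤ.- c)) bot-Z ⟩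
  combine (tot (2 ℕ.+ n) ℤ.+ (c ℤ.+ bot (1 ℕ.+ n) ℤ.* 1ℤ ℤ.+ bot (2 ℕ.+ n) ℤ.* 0ℤ) ℤ.+ + G (2 ℕ.+ n)) (ℤ.- c)
    -- The `q` term of the denominator cancels `+ G (2 ℕ.+ n)`, and its `bot * q ^ 3` term cancels
    -- `c`.
    ≡⟨ simplify (tot (2 ℕ.+ n)) c (bot (1 ℕ.+ n)) (bot (2 ℕ.+ n)) (+ G (2 ℕ.+ n)) (+ G (1 ℕ.+ n)) ⟩
  bot (1 ℕ.+ n) ℤ.+ tot (2 ℕ.+ n)
    ≡⟨ numerator-tail (suc n) ⟨
  numerator (3 ℕ.+ n) ∎
  where
  open ≡-Reasoning
  -G : Series
  -G n = ℤ.- (+ G n)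
  combine : ℤ → ℤ → ℤ
  combine x y = -1ℤ ℤ.* ℤ.- x ℤ.+ (1ℤ ℤ.* -G (2 ℕ.+ n) ℤ.+ (0ℤ ℤ.* -G (1 ℕ.+ n) ℤ.+ y))
  c : ℤ
  c = (bot * genFun G) n
  product : (tail (tail (tail denominator)) * -G) n ≡ ℤ.- c
  product = begin
    (tail (tail (tail denominator)) * -G) n ≡⟨ *-cong {g = -G} denominator-tail (λ _ → refl) n ⟩
    (bot * -G) n                            ≡⟨ *-comm bot -G n ⟩
    (-G * bot) n                            ≡⟨ neg-* (genFun G) bot n ⟩
    ℤ.- (genFun G * bot) n                  ≡⟨ cong ℤ.-_ (*-comm (genFun G) bot n) ⟩
    ℤ.- c                                   ∎
  bot-Z : (bot * Z) (2 ℕ.+ n) ≡ c ℤ.+ bot (1 ℕ.+ n) ℤ.* 1ℤ ℤ.+ bot (2 ℕ.+ n) ℤ.* 0ℤ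
  -- The last two terms of the product carry `Z 1` = 1 and `Z 0` = 0; beyond them `Z` is `G` shifted
  -- by two.
  bot-Z = trans (*-suc bot Z (1 ℕ.+ n))
                (cong (λ x → x ℤ.+ bot (2 ℕ.+ n) ℤ.* 0ℤ) (*-suc bot (tail Z) n))
  simplify : ∀ t c b b′ g g′ →
    -1ℤ ℤ.* ℤ.- (t ℤ.+ (c ℤ.+ b ℤ.* 1ℤ ℤ.+ b′ ℤ.* 0ℤ) ℤ.+ g) ℤ.+
      (1ℤ ℤ.* ℤ.- g ℤ.+ (0ℤ ℤ.* ℤ.- g′ ℤ.+ ℤ.- c)) ≡ b ℤ.+ t
  simplify = ℤ-Solver.solve-∀

mainTheorem6 : F₁ ≈ const 1ℤ + q - const (+ 2) * q ^ 2 *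
    ((const 1ℤ + bot * q ^ 2 + tot * q) / (const -1ℤ + q + bot * q ^ 3) ⟨ denominator-unit ⟩)
mainTheorem6 zero          = refl
mainTheorem6 (suc zero)    = cong +_ (f₁-suc 0)
mainTheorem6 (suc (suc n)) = begin
  + f₁ (2 ℕ.+ n)                              ≡⟨ cong +_ (f₁-suc-suc n) ⟩
  + (2 ℕ.* G n)                               ≡⟨ ℤ.pos-* 2 (G n) ⟩
  + 2 ℤ.* + G n                               ≡⟨ negate (+ G n) ⟩
  -- The leading `0ℤ` is the coefficient of `const 1ℤ + q`, which vanishes from degree 2 on.
  0ℤ ℤ.- + 2 ℤ.* ℤ.- (+ G n)                  ≡⟨ cong (λ x → 0ℤ ℤ.- + 2 ℤ.* x) (quotient≈-G n) ⟨
  0ℤ ℤ.- + 2 ℤ.* quotient n                   ≡⟨ cong (λ x → 0ℤ ℤ.- x) (*-q²-suc quotient n) ⟨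
  0ℤ ℤ.- (const (+ 2) * q ^ 2 * quotient) (2 ℕ.+ n) ∎
  where
  open ≡-Reasoning
  quotient : Series
  quotient = numerator / denominator ⟨ denominator-unit ⟩
  quotient≈-G : quotient ≈ λ n → ℤ.- (+ G n)
  quotient≈-G = quotient-unique {numerator} {denominator} denominator-unit -G-*-denominator
  negate : ∀ x → + 2 ℤ.* x ≡ 0ℤ ℤ.- + 2 ℤ.* ℤ.- x
  negate = ℤ-Solver.solve-∀
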